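{- Let $\mathcal D$ be a finite family of digraphs, each of whose underlying graph is $4$-colorable. Then $$\left|G\left[\operatorname{core}\left(\prod_{D\in\mathcal D}D\right)\right]\right|\le\left|\operatorname{core}\left(\prod_{D\in\mathcal D}G[D]\right)\right|.$$
   Context: All digraphs and graphs are finite, without loops and without parallel arcs/edges; digons (pairs of opposite arcs) are allowed in digraphs. $|X|$ is the number of vertices of $X$. A homomorphism of (di)graphs is a vertex map sending edges to edges (arcs to arcs, preserving direction). $\prod$ is the tensor product: the vertex set is the Cartesian product, with an edge (arc) between $(u_i)_i$ and $(v_i)_i$ iff $u_iv_i$ is an edge (arc) in every coordinate. $\operatorname{core}(X)$ is the (di)graph with the fewest vertices that is homomorphically equivalent to $X$ (homomorphisms in both directions); it is unique up to isomorphism. The graph $K_2\vee C_5$ is the complete join of $K_2$ and the $5$-cycle $C_5$: their disjoint union together with all edges between them. Given a digraph $D$, the (undirected) graph $G[D]$ is built by replacing each arc $u\to v$ of $D$ with its own (vertex-disjoint) copy of $K_2\vee C_5$, where the head $v$ is identified with a vertex of the $K_2$ part and the tail $u$ is identified with a vertex of the $C_5$ part; copies corresponding to distinct arcs share only vertices of $D$. -}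

module Defs where

open import Data.Nat using (ℕ; zero; suc; _+_; _*_; _≤_; _%_)
import Data.Nat.Properties as ℕ
open import Data.Fin using (Fin; zero; suc; toℕ)
import Data.Fin.Properties as Fin
open import Data.Empty using (⊥-elim)
open import Data.Unit using (⊤; tt)
open import Data.Product using (Σ; Σ-syntax; ∃; ∃-syntax; _×_; _,_; proj₁)
open import Data.Product.Function.NonDependent.Propositional using (_×-↔_)
open import Data.Product.Function.Dependent.Propositional using (Σ-↔)
open import Data.Sum using (_⊎_; inj₁; inj₂; swap)
open import Data.Sum.Properties using (inj₁-injective)
open import Data.Sum.Function.Propositional using (_⊎-↔_)
open import Function using (_∘_)
open import Function.Bundles using (_↔_; mk↔ₛ′; Inverse)
open import Function.Properties.Inverse using (↔-refl; ↔-sym; ↔-trans; ↔⇒↣)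
open import Relation.Binary using (Rel; Decidable; DecidableEquality; Symmetric)
open import Relation.Binary.PropositionalEquality
  using (_≡_; _≢_; refl; sym; ≢-sym)
open import Relation.Nullary using (¬_; Dec; yes; no)
open import Relation.Nullary.Decidable
  using (True; toWitness; from-yes; map′; ¬?; _×-dec_; _⊎-dec_; via-injection)

------------------------------------------------------------------------

record Finite (A : Set) : Set where
  constructor mkFinite
  field
    size : ℕ
    enum : A ↔ Fin size

  _≟_ : DecidableEquality A
  _≟_ = via-injection (↔⇒↣ enum) Fin._≟_

  any? : {P : A → Set} → (∀ x → Dec (P x)) → Dec (∃ P)
  any? {P} P? = map′
    (λ (i , p) → Inverse.from enum i , p)
    (λ (x , p) → Inverse.to enum x , back x p)
    (Fin.any? (λ i → P? (Inverse.from enum i)))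
    where
    back : ∀ x → P x → P (Inverse.from enum (Inverse.to enum x))
    back x p rewrite Inverse.strictlyInverseʳ enum x = p

open Finite using (size; enum)

finite-Fin : ∀ {n} → Finite (Fin n)
finite-Fin {n} = mkFinite n ↔-refl

finite-⊤ : Finite ⊤
finite-⊤ = mkFinite 1 (↔-sym Fin.1↔⊤)

finite-⊎ : {A B : Set} → Finite A → Finite B → Finite (A ⊎ B)
finite-⊎ (mkFinite m e) (mkFinite n f) =
  mkFinite (m + n) (↔-trans (e ⊎-↔ f) (↔-sym Fin.+↔⊎))

finite-× : {A B : Set} → Finite A → Finite B → Finite (A × B)
finite-× (mkFinite m e) (mkFinite n f) =
  mkFinite (m * n) (↔-trans (e ×-↔ f) (↔-sym Fin.*↔×))

finite-True : {P : Set} (P? : Dec P) → Finite (True P?)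
finite-True (yes _) = finite-⊤
finite-True (no _)  = mkFinite 0 (↔-sym Fin.0↔⊥)

finite-ΣFin : ∀ n {B : Fin n → Set} → (∀ i → Finite (B i)) → Finite (Σ (Fin n) B)
finite-ΣFin zero    _ = mkFinite 0 (mk↔ₛ′ proj₁ (λ ()) (λ ()) (λ ()))
finite-ΣFin (suc n) {B} b = mkFinite (size rest) (↔-trans split (enum rest))
  where
  rest : Finite (B zero ⊎ Σ (Fin n) (B ∘ suc))
  rest = finite-⊎ (b zero) (finite-ΣFin n (b ∘ suc))

  split : Σ (Fin (suc n)) B ↔ (B zero ⊎ Σ (Fin n) (B ∘ suc))
  split = mk↔ₛ′
    (λ { (zero , x) → inj₁ x ; (suc i , x) → inj₂ (i , x) })
    (λ { (inj₁ x) → zero , x ; (inj₂ (i , x)) → suc i , x })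
    (λ { (inj₁ _) → refl ; (inj₂ _) → refl })
    (λ { (zero , _) → refl ; (suc _ , _) → refl })

finite-Σ : {A : Set} {B : A → Set} → Finite A → (∀ a → Finite (B a)) → Finite (Σ A B)
finite-Σ (mkFinite n e) b = mkFinite (size s)
  (↔-trans (↔-sym (Σ-↔ (↔-sym e) ↔-refl)) (enum s))
  where s = finite-ΣFin n (b ∘ Inverse.from e)

-- Elements of the product of a finite family of types, as nested pairs:
-- plain functions (i : Fin k) → A i would not have the right propositional
-- equality without function extensionality.

Tuple : ∀ {k} → (Fin k → Set) → Set
Tuple {zero}  A = ⊤
Tuple {suc k} A = A zero × Tuple (A ∘ suc)

coord : ∀ {k} (A : Fin k → Set) → Tuple A → ∀ i → A i
coord A (x , _)  zero    = x
coord A (_ , xs) (suc i) = coord (A ∘ suc) xs i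

finite-Tuple : ∀ {k} {A : Fin k → Set} → (∀ i → Finite (A i)) → Finite (Tuple A)
finite-Tuple {zero}  _ = finite-⊤
finite-Tuple {suc k} a = finite-× (a zero) (finite-Tuple (a ∘ suc))

------------------------------------------------------------------------

record Digraph : Set₁ where
  infix 4 _⟶_ _⟶?_
  field
    Vertex   : Set
    finite   : Finite Vertex
    _⟶_      : Rel Vertex _
    _⟶?_     : Decidable _⟶_
    loopless : ∀ {u} → ¬ (u ⟶ u)

  order : ℕ
  order = size finite

  -- True makes the evidence for an arc unique, so that each arc counts once.
  Arc : Set
  Arc = Σ[ (u , v) ∈ Vertex × Vertex ] True (u ⟶? v)

  tail head : Arc → Vertex
  tail ((u , _) , _) = u
  head ((_ , v) , _) = v

  tail⟶head : (a : Arc) → tail a ⟶ head a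
  tail⟶head (_ , t) = toWitness t

  finite-Arc : Finite Arc
  finite-Arc = finite-Σ (finite-× finite finite) (λ (u , v) → finite-True (u ⟶? v))

record Graph : Set₁ where
  field
    digraph   : Digraph
    symmetric : Symmetric (Digraph._⟶_ digraph)

  open Digraph digraph public
    using (Vertex; finite; loopless; order)
    renaming (_⟶_ to _~_; _⟶?_ to _~?_)

open Graph using (digraph)

record Hom (X Y : Digraph) : Set where
  private
    module X = Digraph X
    module Y = Digraph Y
  field
    map      : X.Vertex → Y.Vertex
    preserve : ∀ {u v} → u X.⟶ v → map u Y.⟶ map v

infix 4 _⇄_

_⇄_ : Digraph → Digraph → Set
X ⇄ Y = Hom X Y × Hom Y X

IsCore : Digraph → Digraph → Set₁
IsCore C X = C ⇄ X × (∀ Y → Y ⇄ X → Digraph.order C ≤ Digraph.order Y)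

IsCoreᴳ : Graph → Graph → Set₁
IsCoreᴳ C X =
  digraph C ⇄ digraph X ×
  (∀ (Y : Graph) → digraph Y ⇄ digraph X → Graph.order C ≤ Graph.order Y)

underlying : Digraph → Graph
underlying D = record
  { digraph = record
    { Vertex   = Vertex
    ; finite   = finite
    ; _⟶_      = λ u v → u ⟶ v ⊎ v ⟶ u
    ; _⟶?_     = λ u v → (u ⟶? v) ⊎-dec (v ⟶? u)
    ; loopless = λ { (inj₁ l) → loopless l ; (inj₂ l) → loopless l }
    }
  ; symmetric = swap
  }
  where open Digraph D

Colourable : ℕ → Graph → Set
Colourable n X = Σ[ c ∈ (Vertex → Fin n) ] (∀ {u v} → u ~ v → c u ≢ c v)
  where open Graph X

------------------------------------------------------------------------
-- The family is nonempty: the empty product would be a single vertex with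
-- a loop.

∏ : ∀ {k} → (Fin (suc k) → Digraph) → Digraph
∏ D = record
  { Vertex   = Tuple V
  ; finite   = finite-Tuple (λ i → D.finite i)
  ; _⟶_      = λ u v → ∀ i → D._⟶_ i (coord V u i) (coord V v i)
  ; _⟶?_     = λ u v → Fin.all? (λ i → D._⟶?_ i (coord V u i) (coord V v i))
  ; loopless = λ l → D.loopless zero (l zero)
  }
  where
  module D i = Digraph (D i)
  V = D.Vertex

∏ᴳ : ∀ {k} → (Fin (suc k) → Graph) → Graph
∏ᴳ X = record
  { digraph   = ∏ (digraph ∘ X)
  ; symmetric = λ e i → Graph.symmetric (X i) (e i)
  }

------------------------------------------------------------------------

K : ℕ → Graph
K n = record
  { digraph = record
    { Vertex   = Fin n
    ; finite   = finite-Fin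
    ; _⟶_      = _≢_
    ; _⟶?_     = λ i j → ¬? (i Fin.≟ j)
    ; loopless = λ i≢i → i≢i refl
    }
  ; symmetric = ≢-sym
  }

C₅ : Graph
C₅ = underlying (record
  { Vertex   = Fin 5
  ; finite   = finite-Fin
  ; _⟶_      = λ i j → toℕ j ≡ suc (toℕ i) % 5
  ; _⟶?_     = λ i j → toℕ j ℕ.≟ suc (toℕ i) % 5
  ; loopless = λ {i} →
      from-yes (Fin.all? (λ (i : Fin 5) → ¬? (toℕ i ℕ.≟ suc (toℕ i) % 5))) i
  })

infixr 6 _∨_

_∨_ : Graph → Graph → Graph
X ∨ Y = record
  { digraph = record
    { Vertex   = X.Vertex ⊎ Y.Vertex
    ; finite   = finite-⊎ X.finite Y.finite
    ; _⟶_      = _~_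
    ; _⟶?_     = _~?_
    ; loopless = λ {x} → loopless x
    }
  ; symmetric = λ {x} {y} → symm x y
  }
  where
  module X = Graph X
  module Y = Graph Y

  _~_ : Rel (X.Vertex ⊎ Y.Vertex) _
  inj₁ x ~ inj₁ x′ = x X.~ x′
  inj₁ _ ~ inj₂ _  = ⊤
  inj₂ _ ~ inj₁ _  = ⊤
  inj₂ y ~ inj₂ y′ = y Y.~ y′

  _~?_ : Decidable _~_
  inj₁ x ~? inj₁ x′ = x X.~? x′
  inj₁ _ ~? inj₂ _  = yes tt
  inj₂ _ ~? inj₁ _  = yes tt
  inj₂ y ~? inj₂ y′ = y Y.~? y′

  loopless : ∀ x → ¬ (x ~ x)
  loopless (inj₁ _) = X.loopless
  loopless (inj₂ _) = Y.loopless

  symm : ∀ x y → x ~ y → y ~ x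
  symm (inj₁ _) (inj₁ _) = X.symmetric
  symm (inj₁ _) (inj₂ _) = _
  symm (inj₂ _) (inj₁ _) = _
  symm (inj₂ _) (inj₂ _) = Y.symmetric

K₂∨C₅ : Graph
K₂∨C₅ = K 2 ∨ C₅

------------------------------------------------------------------------

module Gadgets (D : Digraph) where
  open Digraph D
  open Graph K₂∨C₅ using ()
    renaming (Vertex to W; finite to finite-W; _~_ to _~ᵂ_; _~?_ to _~ᵂ?_)

  -- The vertices of D, and for each arc the five vertices of its copy of
  -- K₂ ∨ C₅ that are not identified with a vertex of D: one in K₂, four in C₅.
  GVertex : Set
  GVertex = Vertex ⊎ (Arc × (Fin 1 ⊎ Fin 4))

  finite-G : Finite GVertex
  finite-G = finite-⊎ finite (finite-× finite-Arc (finite-⊎ finite-Fin finite-Fin))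

  copy : Arc → W → GVertex
  copy a (inj₁ zero)    = inj₁ (head a)
  copy a (inj₁ (suc i)) = inj₂ (a , inj₁ i)
  copy a (inj₂ zero)    = inj₁ (tail a)
  copy a (inj₂ (suc j)) = inj₂ (a , inj₂ j)

  _~_ : Rel GVertex _
  x ~ y = ∃[ a ] ∃[ p ] ∃[ q ] (p ~ᵂ q × copy a p ≡ x × copy a q ≡ y)

  _~?_ : Decidable _~_
  x ~? y =
    Finite.any? finite-Arc λ a → Finite.any? finite-W λ p → Finite.any? finite-W λ q →
      (p ~ᵂ? q) ×-dec (Finite._≟_ finite-G (copy a p) x ×-dec Finite._≟_ finite-G (copy a q) y)

  tail≢head : ∀ a → tail a ≢ head a
  tail≢head a@((_ , _) , _) refl = loopless (tail⟶head a)

  copy-injective : ∀ a {p q} → copy a p ≡ copy a q → p ≡ q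
  copy-injective a {inj₁ zero}    {inj₁ zero}    _    = refl
  copy-injective a {inj₁ zero}    {inj₂ zero}    e    = ⊥-elim (tail≢head a (inj₁-injective (sym e)))
  copy-injective a {inj₂ zero}    {inj₁ zero}    e    = ⊥-elim (tail≢head a (inj₁-injective e))
  copy-injective a {inj₂ zero}    {inj₂ zero}    _    = refl
  copy-injective a {inj₁ (suc _)} {inj₂ zero}    ()
  copy-injective a {inj₁ (suc _)} {inj₂ (suc _)} ()
  copy-injective a {inj₂ (suc _)} {inj₁ zero}    ()
  copy-injective a {inj₂ (suc _)} {inj₁ (suc _)} ()
  copy-injective a {inj₁ (suc _)} {inj₁ (suc _)} refl = refl
  copy-injective a {inj₂ (suc _)} {inj₂ (suc _)} refl = refl

  ~-irrefl : ∀ {x} → ¬ (x ~ x)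
  ~-irrefl (a , p , q , p~q , refl , e) with refl ← copy-injective a {p} {q} (sym e) =
    Graph.loopless K₂∨C₅ {p} p~q

  ~-sym : Symmetric _~_
  ~-sym (a , p , q , p~q , e , f) = a , q , p , Graph.symmetric K₂∨C₅ {p} {q} p~q , f , e

G[_] : Digraph → Graph
G[ D ] = record
  { digraph = record
    { Vertex   = GVertex
    ; finite   = finite-G
    ; _⟶_      = _~_
    ; _⟶?_     = _~?_
    ; loopless = ~-irrefl
    }
  ; symmetric = ~-sym
  }
  where open Gadgets D

{-# OPTIONS --safe #-}
module Submission where

-- Put W = K₂ ∨ C₅. Since D i is 4-colourable, and W is not but becomes so when a vertex is deleted,
-- every homomorphism W → G[ D i ] is an automorphism of W followed by the inclusion of a copy.
-- Let r : G[ D i ] → D i send an internal vertex of a copy to the head or the tail of its arc,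
-- according to its part of W. For any φ i : G[ C ] → G[ D i ] the maps θ i = r ∘ φ i restrict to
-- homomorphisms C → D i, and they are jointly injective on C because an endomorphism of a core is
-- injective. If every φ i identifies x and y, then r x ≡ r y. Let x and y lie in the copies of arcs
-- a and b. If every φ i sends these to the same copy, then a ≡ b by injectivity of θ, and x ≡ y.
-- Otherwise some φ i sends them to distinct copies, which meet only in vertices of D i; then φ i x
-- is also the image of r x, so x ≡ r x and likewise y ≡ r y. So every homomorphism
-- G[ C ] → ∏ G[ D i ] is injective, and one of them factors through H.

open import Defs
open import Data.Nat using (ℕ; suc; _≤_; _<_)
import Data.Nat.Properties as ℕ
open import Data.Fin using (Fin; zero; suc)
import Data.Fin.Properties as Fin
open import Data.Fin.Patterns using (0F; 1F; 2F; 3F; 4F)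
open import Data.Fin.Permutation.Components using (transpose)
open import Data.Bool.Properties using (T-irrelevant)
open import Data.Empty using (⊥; ⊥-elim)
open import Data.Unit using (⊤; tt)
open import Data.Product using (Σ-syntax; ∃-syntax; _×_; _,_; proj₁; proj₂)
open import Data.Sum using (_⊎_; inj₁; inj₂; [_,_])
open import Data.Sum.Properties using (inj₁-injective; ≡-dec)
open import Data.Vec using (_∷_; []; lookup)
open import Function using (_∘_; _∋_; case_of_)
open import Function.Bundles using (Inverse; Injection)
open import Function.Definitions using (Injective)
open import Function.Properties.Inverse using (↔-sym; ↔⇒↣)
open import Relation.Binary.PropositionalEquality
  using (_≡_; _≢_; refl; sym; trans; cong; cong₂; subst; subst₂; module ≡-Reasoning)
open import Relation.Nullary using (¬_; Dec; yes; no)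
open import Relation.Nullary.Decidable
  using (True; toWitness; fromWitness; from-yes; map′; ¬?; _×-dec_; _→-dec_; decidable-stable)

open Graph using (digraph)

-- Finite types and tuples.

private
  variable
    A B : Set

injective⇒size≤ : (a : Finite A) (b : Finite B) {f : A → B} → Injective _≡_ _≡_ f →
                  Finite.size a ≤ Finite.size b
injective⇒size≤ a b {f} f-inj = Fin.injective⇒≤ {f = Inverse.to (enum b) ∘ f ∘ Inverse.from (enum a)}
  (Injection.injective (↔⇒↣ (↔-sym (enum a))) ∘ f-inj ∘ Injection.injective (↔⇒↣ (enum b)))
  where open Finite using (enum)

avoiding-injection⇒size< : (a : Finite A) (b : Finite B) {f : A → B} → Injective _≡_ _≡_ f →
                           ∀ y → (∀ x → f x ≢ y) → Finite.size a < Finite.size b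
avoiding-injection⇒size< {A} {B} a b {f} f-inj y f≢y =
  injective⇒size≤ (finite-⊎ finite-⊤ a) b {g} g-inj
  where
  g : ⊤ ⊎ A → B
  g = [ (λ _ → y) , f ]

  g-inj : Injective _≡_ _≡_ g
  g-inj {inj₁ _} {inj₁ _} _ = refl
  g-inj {inj₁ _} {inj₂ x} e = ⊥-elim (f≢y x (sym e))
  g-inj {inj₂ x} {inj₁ _} e = ⊥-elim (f≢y x e)
  g-inj {inj₂ _} {inj₂ _} e = cong inj₂ (f-inj e)

-- A section `s` of `f` is injective. If `s (f z)` differed from `z`, then `s` would miss `z`, which
-- finiteness forbids; so `s` is also a left inverse.
surjective⇒injective : (a : Finite A) {f : A → A} → (∀ y → ∃[ x ] f x ≡ y) → Injective _≡_ _≡_ f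
surjective⇒injective {A} a {f} f-surj {x} {y} fx≡fy = trans (fixed x) (trans (cong s fx≡fy) (sym (fixed y)))
  where
  s : A → A
  s = proj₁ ∘ f-surj

  f∘s : ∀ z → f (s z) ≡ z
  f∘s = proj₂ ∘ f-surj

  s-inj : Injective _≡_ _≡_ s
  s-inj {u} {v} e = trans (sym (f∘s u)) (trans (cong f e) (f∘s v))

  fixed : ∀ z → z ≡ s (f z)
  fixed z = decidable-stable (Finite._≟_ a z (s (f z))) λ z≢ →
    ℕ.<-irrefl refl (avoiding-injection⇒size< a a s-inj z
      λ w sw≡z → z≢ (trans (sym sw≡z) (cong s (trans (sym (f∘s w)) (cong f sw≡z)))))

True-irrelevant : {P : Set} {P? : Dec P} (s t : True P?) → s ≡ t
True-irrelevant = T-irrelevant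

tuple : ∀ {k} {A : Fin k → Set} → (∀ i → A i) → Tuple A
tuple {ℕ.zero} f = tt
tuple {suc k}  f = f zero , tuple (f ∘ suc)

coord-tuple : ∀ {k} (A : Fin k → Set) (f : ∀ i → A i) i → coord A (tuple f) i ≡ f i
coord-tuple A f zero    = refl
coord-tuple A f (suc i) = coord-tuple (A ∘ suc) (f ∘ suc) i

tuple-cong : ∀ {k} {A : Fin k → Set} {f g : ∀ i → A i} → (∀ i → f i ≡ g i) → tuple f ≡ tuple g
tuple-cong {ℕ.zero} _ = refl
tuple-cong {suc k}  e = cong₂ _,_ (e zero) (tuple-cong (e ∘ suc))

-- Homomorphisms, products and cores.

_∘ᴴ_ : ∀ {X Y Z} → Hom Y Z → Hom X Y → Hom X Z
g ∘ᴴ f = record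
  { map      = Hom.map g ∘ Hom.map f
  ; preserve = Hom.preserve g ∘ Hom.preserve f
  }

module _ {k} (D : Fin (suc k) → Digraph) where
  private
    V : Fin (suc k) → Set
    V i = Digraph.Vertex (D i)

  projection : ∀ i → Hom (∏ D) (D i)
  projection i = record { map = λ x → coord V x i ; preserve = λ e → e i }

  ⟨_⟩ : ∀ {X} → (∀ i → Hom X (D i)) → Hom X (∏ D)
  ⟨ f ⟩ = record
    { map      = λ x → tuple (λ i → Hom.map (f i) x)
    ; preserve = λ {u} {v} l i → subst₂ (Digraph._⟶_ (D i))
        (sym (coord-tuple V (λ i → Hom.map (f i) u) i))
        (sym (coord-tuple V (λ i → Hom.map (f i) v) i)) (Hom.preserve (f i) l)
    }

-- The family `h` gives a map from `Y` to the product and on to `H`. Following it by `H→X` yields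
-- another family, over which there is no control; hence the assumption on every `Φ`.
jointly-injective⇒order≤ : ∀ {k} (X : Fin (suc k) → Graph) {Y H : Graph} →
  (∀ i → Hom (digraph Y) (digraph (X i))) →
  ((Φ : ∀ i → Hom (digraph Y) (digraph (X i))) →
    ∀ x y → (∀ i → Hom.map (Φ i) x ≡ Hom.map (Φ i) y) → x ≡ y) →
  digraph H ⇄ digraph (∏ᴳ X) → Graph.order Y ≤ Graph.order H
jointly-injective⇒order≤ X {Y} {H} h jointly-injective (H→∏ , ∏→H) =
  injective⇒size≤ (Graph.finite Y) (Graph.finite H) {Hom.map Y→H} λ {x} {y} e →
    jointly-injective (λ i → H→X i ∘ᴴ Y→H) x y λ i → cong (Hom.map (H→X i)) e
  where
  Y→H : Hom (digraph Y) (digraph H)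
  Y→H = ∏→H ∘ᴴ ⟨_⟩ (digraph ∘ X) h

  H→X : ∀ i → Hom (digraph H) (digraph (X i))
  H→X i = projection (digraph ∘ X) i ∘ᴴ H→∏

-- If an endomorphism missed a vertex, deleting that vertex would leave a smaller equivalent digraph.
core-endomorphism-injective : ∀ {C X} → IsCore C X → (h : Hom C C) → Injective _≡_ _≡_ (Hom.map h)
core-endomorphism-injective {C} {X} ((C→X , X→C) , minimal) h =
  surjective⇒injective finite λ y →
    decidable-stable (Finite.any? finite λ x → map x ≟ y)
      λ h≢y → ℕ.1+n≰n (ℕ.≤-trans (smaller y) (minimal (C∖ y) (equivalent y λ x e → h≢y (x , e))))
  where
  open Digraph C
  open Hom h
  open Finite finite using (_≟_)

  C∖ : Vertex → Digraph
  C∖ y = record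
    { Vertex   = Σ[ x ∈ Vertex ] True (¬? (x ≟ y))
    ; finite   = finite-Σ finite (λ x → finite-True (¬? (x ≟ y)))
    ; _⟶_      = λ (u , _) (v , _) → u ⟶ v
    ; _⟶?_     = λ (u , _) (v , _) → u ⟶? v
    ; loopless = loopless
    }

  smaller : ∀ y → Digraph.order (C∖ y) < order
  smaller y = avoiding-injection⇒size< (Digraph.finite (C∖ y)) finite {proj₁} proj₁-inj y
    (λ (_ , t) → toWitness t)
    where
    proj₁-inj : Injective _≡_ _≡_ proj₁
    proj₁-inj {x , s} {_ , t} refl = cong (x ,_) (True-irrelevant {P? = ¬? (x ≟ y)} s t)

  equivalent : ∀ y → (∀ x → map x ≢ y) → C∖ y ⇄ X
  equivalent y h≢y =
      C→X ∘ᴴ record { map = proj₁ ; preserve = λ l → l }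
    , record { map = λ x → map x , fromWitness (h≢y x) ; preserve = preserve } ∘ᴴ X→C

-- Colourings and adjacency in `K₂ ∨ C₅`.

open Graph K₂∨C₅ using () renaming (Vertex to W; finite to finite-W; _~_ to _~ᵂ_; _~?_ to _~ᵂ?_)

_≟ᵂ_ : (p q : W) → Dec (p ≡ q)
_≟ᵂ_ = ≡-dec Fin._≟_ Fin._≟_

allᵂ? : {P : W → Set} → (∀ p → Dec (P p)) → Dec (∀ p → P p)
allᵂ? P? = map′ (λ (f , g) → λ { (inj₁ i) → f i ; (inj₂ j) → g j })
                (λ f → f ∘ inj₁ , f ∘ inj₂)
                (Fin.all? (P? ∘ inj₁) ×-dec Fin.all? (P? ∘ inj₂))

-- copy a (inj₁ zero) is the head of a and copy a (inj₂ zero) its tail.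
anchor : W → W
anchor (inj₁ _) = inj₁ zero
anchor (inj₂ _) = inj₂ zero

-- `K₂` uses up two colours, and the other two cannot colour an odd cycle.
W-not-4-colourable : ¬ Colourable 4 K₂∨C₅
W-not-4-colourable (c , proper) =
  exhausted (k 0F) (k 1F) (≠ {inj₁ 0F} {inj₁ 1F} λ ())
    (j 0F) (≠ {inj₂ 0F} {inj₁ 0F} tt) (≠ {inj₂ 0F} {inj₁ 1F} tt)
    (j 1F) (≠ {inj₂ 1F} {inj₁ 0F} tt) (≠ {inj₂ 1F} {inj₁ 1F} tt) (≠ {inj₂ 1F} {inj₂ 0F} (inj₂ refl))
    (j 2F) (≠ {inj₂ 2F} {inj₁ 0F} tt) (≠ {inj₂ 2F} {inj₁ 1F} tt) (≠ {inj₂ 2F} {inj₂ 1F} (inj₂ refl))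
    (j 3F) (≠ {inj₂ 3F} {inj₁ 0F} tt) (≠ {inj₂ 3F} {inj₁ 1F} tt) (≠ {inj₂ 3F} {inj₂ 2F} (inj₂ refl))
    (j 4F) (≠ {inj₂ 4F} {inj₁ 0F} tt) (≠ {inj₂ 4F} {inj₁ 1F} tt) (≠ {inj₂ 4F} {inj₂ 3F} (inj₂ refl))
    (≠ {inj₂ 4F} {inj₂ 0F} (inj₁ refl))
  where
  k = c ∘ inj₁
  j = c ∘ inj₂

  ≠ : ∀ {p q} → p ~ᵂ q → c p ≢ c q
  ≠ {p} {q} = proper {p} {q}

  _≢?_ : (x y : Fin 4) → Dec (x ≢ y)
  x ≢? y = ¬? (x Fin.≟ y)

  -- Each inequality comes as soon as its colours are chosen, which prunes the search over all
  -- colourings.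
  exhausted : (a b : Fin 4) → a ≢ b → (x₀ : Fin 4) → x₀ ≢ a → x₀ ≢ b →
    (x₁ : Fin 4) → x₁ ≢ a → x₁ ≢ b → x₁ ≢ x₀ →
    (x₂ : Fin 4) → x₂ ≢ a → x₂ ≢ b → x₂ ≢ x₁ →
    (x₃ : Fin 4) → x₃ ≢ a → x₃ ≢ b → x₃ ≢ x₂ →
    (x₄ : Fin 4) → x₄ ≢ a → x₄ ≢ b → x₄ ≢ x₃ → x₄ ≢ x₀ → ⊥
  exhausted = from-yes (
    Fin.all? λ a → Fin.all? λ b → a ≢? b →-dec
    Fin.all? λ x₀ → x₀ ≢? a →-dec x₀ ≢? b →-dec
    Fin.all? λ x₁ → x₁ ≢? a →-dec x₁ ≢? b →-dec x₁ ≢? x₀ →-dec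
    Fin.all? λ x₂ → x₂ ≢? a →-dec x₂ ≢? b →-dec x₂ ≢? x₁ →-dec
    Fin.all? λ x₃ → x₃ ≢? a →-dec x₃ ≢? b →-dec x₃ ≢? x₂ →-dec
    Fin.all? λ x₄ → x₄ ≢? a →-dec x₄ ≢? b →-dec x₄ ≢? x₃ →-dec x₄ ≢? x₀ →-dec no λ ())

-- A 4-colouring of K₂ ∨ C₅ minus the vertex m, normalised so that the vertices
-- identified with head and tail get colours 0 and 1 whenever they are not m.
deletionColouring : W → W → Fin 4
deletionColouring (inj₁ _) (inj₁ _) = zero
deletionColouring (inj₁ _) (inj₂ j) = lookup (1F ∷ 2F ∷ 1F ∷ 2F ∷ 3F ∷ []) j
deletionColouring (inj₂ _) (inj₁ i) = lookup (0F ∷ 2F ∷ []) i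
deletionColouring (inj₂ m) (inj₂ j) = lookup (lookup
  ( (0F ∷ 1F ∷ 3F ∷ 1F ∷ 3F ∷ [])
  ∷ (1F ∷ 0F ∷ 3F ∷ 1F ∷ 3F ∷ [])
  ∷ (1F ∷ 3F ∷ 0F ∷ 1F ∷ 3F ∷ [])
  ∷ (1F ∷ 3F ∷ 1F ∷ 0F ∷ 3F ∷ [])
  ∷ (1F ∷ 3F ∷ 1F ∷ 3F ∷ 0F ∷ [])
  ∷ []) m) j

deletionColouring-proper : ∀ m p q → p ~ᵂ q → p ≢ m → q ≢ m →
                           deletionColouring m p ≢ deletionColouring m q
deletionColouring-proper = from-yes (allᵂ? λ m → allᵂ? λ p → allᵂ? λ q →
  (p ~ᵂ? q) →-dec ¬? (p ≟ᵂ m) →-dec ¬? (q ≟ᵂ m) →-dec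
  ¬? (deletionColouring m p Fin.≟ deletionColouring m q))

-- A vertex of `K₂` has no non-neighbour besides itself, a vertex of `C₅` exactly two.
no-three-non-neighbours : ∀ w x → x ≢ w → ¬ (w ~ᵂ x) →
  ∀ y → y ≢ w → ¬ (w ~ᵂ y) → y ≢ x →
  ∀ z → z ≢ w → ¬ (w ~ᵂ z) → z ≢ x → z ≢ y → ⊥
no-three-non-neighbours = from-yes (
  allᵂ? λ w → allᵂ? λ x → ¬? (x ≟ᵂ w) →-dec ¬? (w ~ᵂ? x) →-dec
  allᵂ? λ y → ¬? (y ≟ᵂ w) →-dec ¬? (w ~ᵂ? y) →-dec ¬? (y ≟ᵂ x) →-dec
  allᵂ? λ z → ¬? (z ≟ᵂ w) →-dec ¬? (w ~ᵂ? z) →-dec ¬? (z ≟ᵂ x) →-dec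
  ¬? (z ≟ᵂ y) →-dec no λ ())

-- Recognises the `K₂` part by adjacency alone: a vertex of `C₅` is not adjacent to all others.
anchor-universal : ∀ p → (∀ q → q ≢ p → p ~ᵂ q) → anchor p ≡ inj₁ zero
anchor-universal = from-yes (allᵂ? λ p →
  (allᵂ? λ q → ¬? (q ≟ᵂ p) →-dec (p ~ᵂ? q)) →-dec (anchor p ≟ᵂ inj₁ zero))

K₂-full : ∀ p q r → anchor p ≡ inj₁ zero → anchor q ≡ inj₁ zero →
          p ≢ q → r ≢ p → r ≢ q → anchor r ≡ inj₂ zero
K₂-full = from-yes (allᵂ? λ p → allᵂ? λ q → allᵂ? λ r →
  (anchor p ≟ᵂ inj₁ zero) →-dec (anchor q ≟ᵂ inj₁ zero) →-dec
  ¬? (p ≟ᵂ q) →-dec ¬? (r ≟ᵂ p) →-dec ¬? (r ≟ᵂ q) →-dec (anchor r ≟ᵂ inj₂ zero))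

-- The only fixed points of `anchor` are the two vertices identified with head and tail, and these
-- lie in different parts of the join.
anchors-adjacent : ∀ p q → p ≢ q → anchor p ≡ p → anchor q ≡ q → p ~ᵂ q
anchors-adjacent = from-yes (allᵂ? λ p → allᵂ? λ q →
  ¬? (p ≟ᵂ q) →-dec (anchor p ≟ᵂ p) →-dec (anchor q ≟ᵂ q) →-dec (p ~ᵂ? q))

-- A permutation of the colours: the first transposition takes 0 to `s`, the second takes the image
-- of 1 to `t` and fixes `s` when `s ≢ t`.
recolour : Fin 4 → Fin 4 → Fin 4 → Fin 4
recolour s t = transpose (transpose zero s (suc zero)) t ∘ transpose zero s

recolour-0 : ∀ s t → s ≢ t → recolour s t zero ≡ s
recolour-0 = from-yes (Fin.all? λ s → Fin.all? λ t → ¬? (s Fin.≟ t) →-dec recolour s t zero Fin.≟ s)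

recolour-1 : ∀ s t → recolour s t (suc zero) ≡ t
recolour-1 = from-yes (Fin.all? λ s → Fin.all? λ t → recolour s t (suc zero) Fin.≟ t)

recolour-≢ : ∀ s t x y → x ≢ y → recolour s t x ≢ recolour s t y
recolour-≢ = from-yes (Fin.all? λ s → Fin.all? λ t → Fin.all? λ x → Fin.all? λ y →
  ¬? (x Fin.≟ y) →-dec ¬? (recolour s t x Fin.≟ recolour s t y))

internal : Fin 1 ⊎ Fin 4 → W
internal (inj₁ i) = inj₁ (suc i)
internal (inj₂ j) = inj₂ (suc j)

deletionColouring-head : ∀ m → deletionColouring (internal m) (inj₁ zero) ≡ zero
deletionColouring-head (inj₁ _) = refl
deletionColouring-head (inj₂ _) = refl

deletionColouring-tail : ∀ m → deletionColouring (internal m) (inj₂ zero) ≡ suc zero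
deletionColouring-tail (inj₁ _) = refl
deletionColouring-tail (inj₂ j) =
  from-yes (Fin.all? λ j → deletionColouring (inj₂ (suc j)) (inj₂ zero) Fin.≟ suc zero) j

-- Endomorphisms of `K₂ ∨ C₅`.

module Endomorphism (e : Hom (digraph K₂∨C₅) (digraph K₂∨C₅)) where
  open Hom e

  abstract
    -- If `m` were missed, pulling back the deletion colouring at `m` would 4-colour `W`.
    surjective : ∀ m → ∃[ p ] map p ≡ m
    surjective m = decidable-stable (Finite.any? finite-W λ p → map p ≟ᵂ m) λ e≢m →
      W-not-4-colourable
        ( deletionColouring m ∘ map
        , λ {p} {q} p~q → deletionColouring-proper m (map p) (map q) (preserve {p} {q} p~q)
            (λ ep≡m → e≢m (p , ep≡m)) (λ eq≡m → e≢m (q , eq≡m)))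

  injective : Injective _≡_ _≡_ map
  injective = surjective⇒injective finite-W surjective

  -- By surjectivity, a vertex adjacent to all others has an image adjacent to all others.
  anchor-K₂ : ∀ i → anchor (map (inj₁ i)) ≡ inj₁ zero
  anchor-K₂ i = anchor-universal (map (inj₁ i)) neighbour
    where
    universal : ∀ q → inj₁ i ≢ q → inj₁ i ~ᵂ q
    universal (inj₁ _) i≢q refl = i≢q refl
    universal (inj₂ _) _        = tt

    neighbour : ∀ q → q ≢ map (inj₁ i) → map (inj₁ i) ~ᵂ q
    neighbour q q≢ = let p , ep≡q = surjective q in
      subst (map (inj₁ i) ~ᵂ_) ep≡q
        (preserve {inj₁ i} {p} (universal p λ i≡p → q≢ (trans (sym ep≡q) (cong map (sym i≡p)))))

  -- The images of `K₂` already fill `K₂`, so injectivity leaves only `C₅`.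
  anchor-C₅ : ∀ j → anchor (map (inj₂ j)) ≡ inj₂ zero
  anchor-C₅ j = K₂-full _ _ (map (inj₂ j)) (anchor-K₂ zero) (anchor-K₂ (suc zero))
    (λ e → case injective e of λ ()) (λ e → case injective e of λ ()) (λ e → case injective e of λ ())

  anchor-preserved : ∀ p → anchor (map p) ≡ anchor p
  anchor-preserved (inj₁ i) = anchor-K₂ i
  anchor-preserved (inj₂ j) = anchor-C₅ j

-- Copies of `K₂ ∨ C₅` inside `G[ D ]`.

module Copies (D : Digraph) where
  open Digraph D
  open Gadgets D public using (GVertex; copy; copy-injective)
  open Gadgets D using (~-irrefl) renaming (_~_ to _~ᴳ_)

  retract : GVertex → Vertex
  retract (inj₁ v)            = v
  retract (inj₂ (a , inj₁ _)) = head a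
  retract (inj₂ (a , inj₂ _)) = tail a

  -- Links the retraction `anchor` inside one copy with `retract` on the whole of `G[ D ]`.
  copy-anchor : ∀ a p → copy a (anchor p) ≡ inj₁ (retract (copy a p))
  copy-anchor a (inj₁ zero)    = refl
  copy-anchor a (inj₁ (suc _)) = refl
  copy-anchor a (inj₂ zero)    = refl
  copy-anchor a (inj₂ (suc _)) = refl

  copy-internal : ∀ a m → copy a (internal m) ≡ inj₂ (a , m)
  copy-internal a (inj₁ _) = refl
  copy-internal a (inj₂ _) = refl

  copyᴴ : Arc → Hom (digraph K₂∨C₅) (digraph G[ D ])
  copyᴴ a = record { map = copy a ; preserve = λ {p} {q} p~q → a , p , q , p~q , refl , refl }

  _≟ᴬ_ : (a b : Arc) → Dec (a ≡ b)
  _≟ᴬ_ = Finite._≟_ finite-Arc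

  arc-≡ : ∀ {a b} → tail a ≡ tail b → head a ≡ head b → a ≡ b
  arc-≡ {(u , v) , s} {_ , t} refl refl = cong ((u , v) ,_) (True-irrelevant {P? = u ⟶? v} s t)

  -- Distinct copies share only vertices of `D`, which are the fixed points of `anchor` in each
  -- copy.
  meet-at-anchor : ∀ {a b} p q → a ≢ b → copy a p ≡ copy b q → anchor p ≡ p
  meet-at-anchor (inj₁ zero)    _              _   _    = refl
  meet-at-anchor (inj₂ zero)    _              _   _    = refl
  meet-at-anchor (inj₁ (suc _)) (inj₁ (suc _)) a≢b refl = ⊥-elim (a≢b refl)
  meet-at-anchor (inj₁ (suc _)) (inj₂ zero)    _   ()
  meet-at-anchor (inj₁ (suc _)) (inj₂ (suc _)) _   ()
  meet-at-anchor (inj₂ (suc _)) (inj₁ zero)    _   ()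
  meet-at-anchor (inj₂ (suc _)) (inj₁ (suc _)) _   ()
  meet-at-anchor (inj₂ (suc _)) (inj₂ (suc _)) a≢b refl = ⊥-elim (a≢b refl)

  -- If the edge comes from another copy, both ends lie in two copies, so they are the head and tail
  -- vertices of the copy of `a`, and these are adjacent.
  copy-reflects-~ : ∀ a {p q} → copy a p ~ᴳ copy a q → p ~ᵂ q
  copy-reflects-~ a {p} {q} l@(b , p′ , q′ , p′~q′ , p′≡p , q′≡q) with a ≟ᴬ b
  ... | yes refl = subst₂ _~ᵂ_ (copy-injective a p′≡p) (copy-injective a q′≡q) p′~q′
  ... | no a≢b   = anchors-adjacent p q (λ { refl → ~-irrefl l })
    (meet-at-anchor p p′ a≢b (sym p′≡p)) (meet-at-anchor q q′ a≢b (sym q′≡q))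

  neighbour-of-internal : ∀ {x a} m → x ~ᴳ inj₂ (a , m) → ∃[ p ] copy a p ≡ x
  neighbour-of-internal _ (a , p , inj₁ (suc _) , _ , e , refl) = p , e
  neighbour-of-internal _ (a , p , inj₂ (suc _) , _ , e , refl) = p , e

-- Homomorphisms from `K₂ ∨ C₅` to `G[ D ]`.

module Factorisation (D : Digraph) (colouring : Colourable 4 (underlying D))
                     (ψ : Hom (digraph K₂∨C₅) (digraph G[ D ])) where
  open Digraph D
  open Copies D
  open Gadgets D using (finite-G) renaming (_~_ to _~ᴳ_)
  open Hom ψ

  private
    c = proj₁ colouring
    _≟ᴳ_ = Finite._≟_ finite-G

    Hit : Arc → Fin 1 ⊎ Fin 4 → Set
    Hit a m = ∃[ p ] map p ≡ inj₂ (a , m)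

    hit? : ∀ a m → Dec (Hit a m)
    hit? a m = Finite.any? finite-W λ p → map p ≟ᴳ inj₂ (a , m)

    Missing : Arc → Set
    Missing a = ∃[ m ] ¬ Hit a m

    missing? : ∀ a → Dec (Missing a)
    missing? a = Finite.any? (finite-⊎ finite-Fin finite-Fin) λ m → ¬? (hit? a m)

  module _ (missing : ∀ a → Missing a) where
    private
      m : Arc → Fin 1 ⊎ Fin 4
      m = proj₁ ∘ missing

      -- Makes the colouring of each copy agree with `c` at head and tail, so that the copies glue.
      -- The two colours differ because head and tail are adjacent in `D`.
      π : Arc → Fin 4 → Fin 4
      π a = recolour (c (head a)) (c (tail a))

      χ : GVertex → Fin 4
      χ (inj₁ v)       = c v
      χ (inj₂ (a , i)) = π a (deletionColouring (internal (m a)) (internal i))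

      χ-copy : ∀ a p → χ (copy a p) ≡ π a (deletionColouring (internal (m a)) p)
      χ-copy a (inj₁ zero)    = sym (trans (cong (π a) (deletionColouring-head (m a)))
        (recolour-0 _ _ (proj₂ colouring (inj₂ (tail⟶head a)))))
      χ-copy a (inj₁ (suc _)) = refl
      χ-copy a (inj₂ zero)    = sym (trans (cong (π a) (deletionColouring-tail (m a)))
        (recolour-1 (c (head a)) _))
      χ-copy a (inj₂ (suc _)) = refl

      avoids : ∀ a {p} x → copy a p ≡ map x → p ≢ internal (m a)
      avoids a x e refl = proj₂ (missing a) (x , trans (sym e) (copy-internal a (m a)))

      χ-proper : ∀ x y → map x ~ᴳ map y → χ (map x) ≢ χ (map y)
      χ-proper x y (a , p , q , p~q , p≡ , q≡) χ≡ =
        recolour-≢ (c (head a)) (c (tail a)) _ _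
          (deletionColouring-proper (internal (m a)) p q p~q (avoids a x p≡) (avoids a y q≡))
          (trans (sym (χ-copy a p)) (trans (cong χ p≡) (trans χ≡ (trans (cong χ (sym q≡)) (χ-copy a q)))))

    -- On each copy `χ` can fail to be proper only at edges meeting the missing vertex, and `ψ`
    -- avoids these vertices; so `χ` pulls back to a 4-colouring of `W`.
    missing-everywhere-absurd : ⊥
    missing-everywhere-absurd = W-not-4-colourable
      (χ ∘ map , λ {x} {y} x~y → χ-proper x y (preserve {x} {y} x~y))

  private
    abstract
      saturated : ∃[ a ] ¬ Missing a
      saturated = decidable-stable (Finite.any? finite-Arc λ a → ¬? (missing? a)) λ none →
        missing-everywhere-absurd λ a → decidable-stable (missing? a) λ ¬missing → none (a , ¬missing)

  arc : Arc
  arc = proj₁ saturated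

  private
    abstract
      preimage : ∀ m → Hit arc m
      preimage m = decidable-stable (hit? arc m) λ ¬hit → proj₂ saturated (m , ¬hit)

    InCopy : W → Set
    InCopy w = ∃[ p ] copy arc p ≡ map w

    abstract
      -- The preimages of three internal vertices of the copy would be non-neighbours of w.
      in-copy : ∀ w → InCopy w
      in-copy w = decidable-stable (Finite.any? finite-W λ p → copy arc p ≟ᴳ map w) absurd
        where
        x : Fin 4 → W
        x j = proj₁ (preimage (inj₂ j))

        ψx : ∀ j → map (x j) ≡ inj₂ (arc , inj₂ j)
        ψx j = proj₂ (preimage (inj₂ j))

        x-injective : ∀ {i j} → x i ≡ x j → i ≡ j
        x-injective {i} {j} e = index (trans (sym (ψx i)) (trans (cong map e) (ψx j)))
          where
          index : ∀ {i j} → inj₂ (arc , inj₂ i) ≡ (GVertex ∋ inj₂ (arc , inj₂ j)) → i ≡ j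
          index refl = refl

        x-distinct : ∀ {i j} → i ≢ j → x i ≢ x j
        x-distinct i≢j e = i≢j (x-injective e)

        absurd : ¬ ¬ InCopy w
        absurd ∉copy = no-three-non-neighbours w
          (x 0F) (x≢w 0F) (w≁x 0F)
          (x 1F) (x≢w 1F) (w≁x 1F) (x-distinct {1F} {0F} λ ())
          (x 2F) (x≢w 2F) (w≁x 2F) (x-distinct {2F} {0F} λ ()) (x-distinct {2F} {1F} λ ())
          where
          x≢w : ∀ j → x j ≢ w
          x≢w j e = ∉copy (inj₂ (suc j) , trans (sym (ψx j)) (cong map e))

          w≁x : ∀ j → ¬ (w ~ᵂ x j)
          w≁x j l = ∉copy (neighbour-of-internal (inj₂ j) (subst (map w ~ᴳ_) (ψx j) (preserve {w} {x j} l)))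

  endomorphism : Hom (digraph K₂∨C₅) (digraph K₂∨C₅)
  endomorphism = record
    { map      = proj₁ ∘ in-copy
    ; preserve = λ {u} {v} l → copy-reflects-~ arc
        (subst₂ _~ᴳ_ (sym (proj₂ (in-copy u))) (sym (proj₂ (in-copy v))) (preserve {u} {v} l))
    }

  open Endomorphism endomorphism

  factors : ∀ p → copy arc (Hom.map endomorphism p) ≡ map p
  factors p = proj₂ (in-copy p)

  map-injective : Injective _≡_ _≡_ map
  map-injective {p} {q} e =
    injective (copy-injective arc (trans (factors p) (trans e (sym (factors q)))))

  -- `ψ` differs from the plain copy at `arc` by an endomorphism preserving both parts of `W`, and
  -- `retract` sees only the part.
  retract-map : ∀ p → retract (map p) ≡ retract (copy arc p)
  retract-map p = inj₁-injective (begin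
    inj₁ (retract (map p))                             ≡⟨ cong (inj₁ ∘ retract) (factors p) ⟨
    inj₁ (retract (copy arc (Hom.map endomorphism p))) ≡⟨ copy-anchor arc (Hom.map endomorphism p) ⟨
    copy arc (anchor (Hom.map endomorphism p))         ≡⟨ cong (copy arc) (anchor-preserved p) ⟩
    copy arc (anchor p)                                ≡⟨ copy-anchor arc p ⟩
    inj₁ (retract (copy arc p))                        ∎)
    where open ≡-Reasoning

-- Functoriality of `G`.

G-map : ∀ {C D} → Hom C D → Hom (digraph G[ C ]) (digraph G[ D ])
G-map {C} {D} σ = record
  { map      = onG
  ; preserve = λ { (a , p , q , p~q , refl , refl) →
      onArc a , p , q , p~q , onG-copy a p , onG-copy a q }
  }
  where
  module C = Digraph C
  module D = Digraph D
  open Hom σ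

  onArc : C.Arc → D.Arc
  onArc a = (map (C.tail a) , map (C.head a)) , fromWitness (preserve (C.tail⟶head a))

  onG : Gadgets.GVertex C → Gadgets.GVertex D
  onG (inj₁ v)       = inj₁ (map v)
  onG (inj₂ (a , i)) = inj₂ (onArc a , i)

  onG-copy : ∀ a p → Gadgets.copy D (onArc a) p ≡ onG (Gadgets.copy C a p)
  onG-copy a (inj₁ zero)    = refl
  onG-copy a (inj₁ (suc _)) = refl
  onG-copy a (inj₂ zero)    = refl
  onG-copy a (inj₂ (suc _)) = refl

-- Joint injectivity on `G[ C ]`.

module _ {k} (D : Fin (suc k) → Digraph) (colouring : ∀ i → Colourable 4 (underlying (D i)))
         {C : Digraph} (core : IsCore C (∏ D))
         (Φ : ∀ i → Hom (digraph G[ C ]) (digraph G[ D i ])) where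
  private
    module C = Digraph C
    module Cᶜ = Copies C
    module Dᶜ i = Copies (D i)
    module F i a = Factorisation (D i) (colouring i) (Φ i ∘ᴴ Cᶜ.copyᴴ a)

    φ : ∀ i → Cᶜ.GVertex → Dᶜ.GVertex i
    φ i = Hom.map (Φ i)

    θ : ∀ i → C.Vertex → Digraph.Vertex (D i)
    θ i v = Dᶜ.retract i (φ i (inj₁ v))

    retract-φ-copy : ∀ i a p → Dᶜ.retract i (φ i (Cᶜ.copy a p)) ≡ Dᶜ.retract i (Dᶜ.copy i (F.arc i a) p)
    retract-φ-copy i a = F.retract-map i a

    -- Together with `θ-head`: `θ i` carries the arc `a` to the arc whose copy receives the copy of
    -- `a`.
    θ-tail : ∀ i a → θ i (C.tail a) ≡ Digraph.tail (D i) (F.arc i a)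
    θ-tail i a = retract-φ-copy i a (inj₂ zero)

    θ-head : ∀ i a → θ i (C.head a) ≡ Digraph.head (D i) (F.arc i a)
    θ-head i a = retract-φ-copy i a (inj₁ zero)

    θᴴ : ∀ i → Hom C (D i)
    θᴴ i = record
      { map      = θ i
      ; preserve = λ {u} {v} l → let a = (u , v) , fromWitness l in
          subst₂ (Digraph._⟶_ (D i)) (sym (θ-tail i a)) (sym (θ-head i a))
            (Digraph.tail⟶head (D i) (F.arc i a))
      }

    -- The `θᴴ i` combine to a map `C → ∏ D`; returning to `C` gives an endomorphism of a core.
    θ-injective : ∀ {u v} → (∀ i → θ i u ≡ θ i v) → u ≡ v
    θ-injective e = core-endomorphism-injective core (proj₂ (proj₁ core) ∘ᴴ ⟨_⟩ D θᴴ)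
      (cong (Hom.map (proj₂ (proj₁ core))) (tuple-cong e))

    θ-retract : ∀ i x → Dᶜ.retract i (φ i x) ≡ θ i (Cᶜ.retract x)
    θ-retract i (inj₁ v) = refl
    θ-retract i (inj₂ (a , inj₁ j)) = trans (retract-φ-copy i a (inj₁ (suc j))) (sym (θ-head i a))
    θ-retract i (inj₂ (a , inj₂ j)) = trans (retract-φ-copy i a (inj₂ (suc j))) (sym (θ-tail i a))

    retract-≡ : ∀ {x y} → (∀ i → φ i x ≡ φ i y) → Cᶜ.retract x ≡ Cᶜ.retract y
    retract-≡ {x} {y} e = θ-injective λ i →
      trans (sym (θ-retract i x)) (trans (cong (Dᶜ.retract i) (e i)) (θ-retract i y))

    copy-injective : ∀ a {p q} → (∀ i → φ i (Cᶜ.copy a p) ≡ φ i (Cᶜ.copy a q)) → p ≡ q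
    -- A single coordinate separates the vertices of a copy, and `zero` exists because the family is
    -- nonempty.
    copy-injective a e = F.map-injective zero a (e zero)

    -- Distinct copies in G[ D i ] meet only in vertices of D i, so φ i identifies
    -- copy a p with the vertex of C it retracts to.
    at-anchor : ∀ i a b p q → F.arc i a ≢ F.arc i b →
                Cᶜ.retract (Cᶜ.copy a p) ≡ Cᶜ.retract (Cᶜ.copy b q) →
                φ i (Cᶜ.copy a p) ≡ φ i (Cᶜ.copy b q) → anchor p ≡ p
    at-anchor i a b p q a≢b r≡ φ≡ = F.map-injective i a (begin
      φ i (Cᶜ.copy a (anchor p))                        ≡⟨ shared (anchor p) (anchor q) anchor≡ ⟩
      inj₁ (Dᶜ.retract i (φ i (Cᶜ.copy a (anchor p))))  ≡⟨ cong (inj₁ ∘ Dᶜ.retract i ∘ φ i) (Cᶜ.copy-anchor a p) ⟩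
      inj₁ (θ i (Cᶜ.retract (Cᶜ.copy a p)))             ≡⟨ cong inj₁ (θ-retract i (Cᶜ.copy a p)) ⟨
      inj₁ (Dᶜ.retract i (φ i (Cᶜ.copy a p)))           ≡⟨ shared p q φ≡ ⟨
      φ i (Cᶜ.copy a p)                                 ∎)
      where
      open ≡-Reasoning

      anchor≡ : φ i (Cᶜ.copy a (anchor p)) ≡ φ i (Cᶜ.copy b (anchor q))
      anchor≡ = cong (φ i) (trans (Cᶜ.copy-anchor a p) (trans (cong inj₁ r≡) (sym (Cᶜ.copy-anchor b q))))

      shared : ∀ p q → φ i (Cᶜ.copy a p) ≡ φ i (Cᶜ.copy b q) →
               φ i (Cᶜ.copy a p) ≡ inj₁ (Dᶜ.retract i (φ i (Cᶜ.copy a p)))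
      shared p q e = begin
        φ i (Cᶜ.copy a p)                                  ≡⟨ F.factors i a p ⟨
        Dᶜ.copy i (F.arc i a) p′                           ≡⟨ cong (Dᶜ.copy i (F.arc i a))
                                                                (Dᶜ.meet-at-anchor i p′ q′ a≢b p′≡q′) ⟨
        Dᶜ.copy i (F.arc i a) (anchor p′)                  ≡⟨ Dᶜ.copy-anchor i (F.arc i a) p′ ⟩
        inj₁ (Dᶜ.retract i (Dᶜ.copy i (F.arc i a) p′))     ≡⟨ cong (inj₁ ∘ Dᶜ.retract i) (F.factors i a p) ⟩
        inj₁ (Dᶜ.retract i (φ i (Cᶜ.copy a p)))            ∎
        where
        p′ = Hom.map (F.endomorphism i a) p
        q′ = Hom.map (F.endomorphism i b) q
        p′≡q′ = trans (F.factors i a p) (trans e (sym (F.factors i b q)))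

    same-arc : ∀ {a b} p q → a ≡ b → (∀ i → φ i (Cᶜ.copy a p) ≡ φ i (Cᶜ.copy b q)) →
               Cᶜ.copy a p ≡ Cᶜ.copy b q
    same-arc {a} p q refl e = cong (Cᶜ.copy a) (copy-injective a e)

    -- If all coordinates agree on the copies, `θ` identifies tails and heads, so `a ≡ b`. Otherwise
    -- a coordinate that separates them forces `p` and `q` to be anchors, and two vertices of `C`
    -- remain to be compared.
    copies : ∀ a b p q → Dec (∀ i → F.arc i a ≡ F.arc i b) →
             (∀ i → φ i (Cᶜ.copy a p) ≡ φ i (Cᶜ.copy b q)) → Cᶜ.copy a p ≡ Cᶜ.copy b q
    copies a b p q (yes same) e = same-arc p q a≡b e
      where
      a≡b : a ≡ b
      a≡b = Cᶜ.arc-≡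
        (θ-injective λ i → trans (θ-tail i a) (trans (cong (Digraph.tail (D i)) (same i)) (sym (θ-tail i b))))
        (θ-injective λ i → trans (θ-head i a) (trans (cong (Digraph.head (D i)) (same i)) (sym (θ-head i b))))
    copies a b p q (no ¬same) e = begin
      Cᶜ.copy a p                      ≡⟨ cong (Cᶜ.copy a) (at-anchor i a b p q a≢b r≡ (e i)) ⟨
      Cᶜ.copy a (anchor p)             ≡⟨ Cᶜ.copy-anchor a p ⟩
      inj₁ (Cᶜ.retract (Cᶜ.copy a p))  ≡⟨ cong inj₁ r≡ ⟩
      inj₁ (Cᶜ.retract (Cᶜ.copy b q))  ≡⟨ Cᶜ.copy-anchor b q ⟨
      Cᶜ.copy b (anchor q)             ≡⟨ cong (Cᶜ.copy b) (at-anchor i b a q p (a≢b ∘ sym) (sym r≡) (sym (e i))) ⟩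
      Cᶜ.copy b q                      ∎
      where
      open ≡-Reasoning
      differ : ∃[ i ] F.arc i a ≢ F.arc i b
      differ = Fin.¬∀⟶∃¬ _ _ (λ i → Dᶜ._≟ᴬ_ i (F.arc i a) (F.arc i b)) ¬same
      i = proj₁ differ
      a≢b = proj₂ differ
      r≡ = retract-≡ e

    same? : ∀ a b → Dec (∀ i → F.arc i a ≡ F.arc i b)
    same? a b = Fin.all? λ i → Dᶜ._≟ᴬ_ i (F.arc i a) (F.arc i b)

    -- Equal retractions place `v` itself in the copy of `a`, where injectivity on one copy applies.
    vertex-copy : ∀ v a p → (∀ i → φ i (inj₁ v) ≡ φ i (Cᶜ.copy a p)) → inj₁ v ≡ Cᶜ.copy a p
    vertex-copy v a p e = trans v≡ (cong (Cᶜ.copy a) (copy-injective a λ i → trans (cong (φ i) (sym v≡)) (e i)))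
      where
      v≡ : inj₁ v ≡ Cᶜ.copy a (anchor p)
      v≡ = trans (cong inj₁ (retract-≡ e)) (sym (Cᶜ.copy-anchor a p))

  jointly-injective : ∀ x y → (∀ i → φ i x ≡ φ i y) → x ≡ y
  jointly-injective (inj₁ u)       (inj₁ v)       e = cong inj₁ (retract-≡ e)
  jointly-injective (inj₁ u)       (inj₂ (b , n)) e =
    trans (vertex-copy u b (internal n) λ i → trans (e i) (cong (φ i) (sym (Cᶜ.copy-internal b n))))
          (Cᶜ.copy-internal b n)
  jointly-injective x@(inj₂ _)     y@(inj₁ _)     e = sym (jointly-injective y x (sym ∘ e))
  jointly-injective (inj₂ (a , m)) (inj₂ (b , n)) e =
    subst₂ _≡_ (Cᶜ.copy-internal a m) (Cᶜ.copy-internal b n)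
      (copies a b (internal m) (internal n) (same? a b) λ i →
        subst₂ (λ x y → φ i x ≡ φ i y) (sym (Cᶜ.copy-internal a m)) (sym (Cᶜ.copy-internal b n)) (e i))

theorem45 : (k : ℕ) (D : Fin (suc k) → Digraph) → (∀ i → Colourable 4 (underlying (D i))) →
    (C : Digraph) → IsCore C (∏ D) →
    (H : Graph) → IsCoreᴳ H (∏ᴳ (λ i → G[ D i ])) →
    Graph.order G[ C ] ≤ Graph.order H
theorem45 k D colouring C core H (H⇄∏G , _) =
  jointly-injective⇒order≤ (λ i → G[ D i ]) {G[ C ]} {H}
    -- The maps `C → ∏ D → D i`, lifted by functoriality of `G`.
    (λ i → G-map {C} {D i} (projection D i ∘ᴴ proj₁ (proj₁ core)))
    (jointly-injective D colouring core) H⇄∏G
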